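{- Let $n\ge 6$ and $T_{6,n}=C_6\Box C_n$. Then $\chi(T_{6,n}^2)=6$.
   Context: $C_j$ denotes the cycle on $j$ vertices; $\Box$ is the Cartesian product of graphs. The square $G^2$ of a graph $G$ has vertex set $V(G)$, two distinct vertices being adjacent iff their distance in $G$ is at most 2. $\chi$ is the chromatic number. -}

module Defs where

open import Data.Nat using (ℕ; suc; _<_)
open import Data.Nat.DivMod using (_%_)
open import Data.Fin using (Fin; toℕ)
open import Data.Product using (Σ; _×_; _,_)
open import Data.Sum using (_⊎_)
open import Relation.Binary.PropositionalEquality using (_≡_)
open import Relation.Nullary using (¬_)

-- A graph on a vertex type V, given by its (symmetric, irreflexive) adjacency relation.
record Graph : Set₁ where
  field
    V   : Set
    Adj : V → V → Set

open Graph public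

-- Cycle C_(suc m) on vertex set Fin (suc m) (= ℤ_(m+1)):
-- i ~ j  iff  j ≡ i+1 (mod m+1)  or  i ≡ j+1 (mod m+1).
-- (A genuine cycle for m+1 ≥ 3.)
Cycle : ℕ → Graph
Cycle m = record
  { V   = Fin (suc m)
  ; Adj = λ i j → (toℕ j ≡ suc (toℕ i) % suc m) ⊎ (toℕ i ≡ suc (toℕ j) % suc m)
  }

_□_ : Graph → Graph → Graph
G □ H = record
  { V   = V G × V H
  ; Adj = λ { (g , h) (g' , h') → (g ≡ g' × Adj H h h') ⊎ (Adj G g g' × h ≡ h') }
  }

-- Square G²: distinct u, v adjacent iff dist_G(u,v) ≤ 2, i.e. u ~ v or u, v have a
-- common neighbour.
square : Graph → Graph
square G = record
  { V   = V G
  ; Adj = λ u v → ¬ (u ≡ v) × (Adj G u v ⊎ Σ (V G) (λ w → Adj G u w × Adj G w v))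
  }

Colorable : Graph → ℕ → Set
Colorable G k = Σ (V G → Fin k) (λ c → ∀ u v → Adj G u v → ¬ (c u ≡ c v))

ChromaticNumberIs : Graph → ℕ → Set
ChromaticNumberIs G k = Colorable G k × (∀ m → m < k → ¬ Colorable G m)

{-# OPTIONS --safe #-}
-- Lower bound: in the square, a closed neighbourhood of the torus is a clique of size 5.
-- With fewer than 6 colours two vertices of a copy of C₆ share a colour, and they must be
-- antipodal, (x , 0) and (x + 3 , 0).  The closed neighbourhoods of (x + 1 , 1) and
-- (x + 2 , 1) must both use that colour, which is only possible at (x + 1 , 2) and
-- (x + 2 , 2); but these are adjacent.
--
-- Upper bound: colour (x , j) by x + s j mod 6.  This is proper as soon as consecutive
-- shifts s j, s (j + 1) are distinct and non-adjacent in C₆ and s j ≠ s (j + 2).  Closed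
-- sequences of shifts of lengths 3, 4 and 5 that all start with 0, 4 can be concatenated.
module Submission where

open import Defs
open import Data.Nat using (ℕ; zero; suc; _+_; _≤_; _<_; s≤s; s≤s⁻¹; NonZero)
import Data.Nat.Properties as ℕ
open import Data.Nat.DivMod using (_%_; _mod_; m<n⇒m%n≡m; n%n≡0; [m+n]%n≡m%n; m%n%n≡m%n; %-distribˡ-+)
open import Data.Fin using (Fin; toℕ; _↑ˡ_; #_) renaming (_<_ to _<ᶠ_)
open import Data.Fin.Properties
  using (_≟_; _<?_; all?; any?; pigeonhole; toℕ-injective; toℕ<n; toℕ-↑ˡ; ↑ˡ-injective)
open import Data.Vec using ([]; _∷_; lookup)
open import Data.Product using (Σ; _×_; _,_; proj₁; proj₂; map₂; uncurry)
open import Data.Product.Properties using (≡-dec; ×-≡,≡→≡)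
open import Data.Sum as Sum using (_⊎_; inj₁; inj₂)
open import Function using (_∘_)
open import Function.Definitions using (Injective)
open import Relation.Nullary using (¬_; Dec; contradiction)
open import Relation.Nullary.Decidable using (True; toWitness; from-yes; map′; ¬?; _×-dec_; _⊎-dec_; _→-dec_)
open import Relation.Binary.Definitions using (Decidable; DecidableEquality)
open import Relation.Binary.PropositionalEquality
  using (_≡_; _≢_; refl; sym; trans; cong; subst; module ≡-Reasoning)

-- Decidable adjacency and passage to subgraphs

C₆ : Graph
C₆ = Cycle 5

-- Adjacency is decided over any finite vertex type through its search procedure.
Searchable : Set → Set₁
Searchable A = {P : A → Set} → (∀ x → Dec (P x)) → Dec (Σ A P)

search-× : ∀ {A B} → Searchable A → Searchable B → Searchable (A × B)
search-× a b P? =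
  map′ (λ (x , y , p) → (x , y) , p) (λ ((x , y) , p) → x , y , p) (a λ x → b λ y → P? (x , y))

Cycle-adj? : ∀ m → Decidable (Adj (Cycle m))
Cycle-adj? m i j = (toℕ j ℕ.≟ _) ⊎-dec (toℕ i ℕ.≟ _)

□-adj? : ∀ G H → DecidableEquality (V G) → DecidableEquality (V H) →
         Decidable (Adj G) → Decidable (Adj H) → Decidable (Adj (G □ H))
□-adj? G H _≟ᴳ_ _≟ᴴ_ adjᴳ? adjᴴ? (g , h) (g' , h') =
  ((g ≟ᴳ g') ×-dec adjᴴ? h h') ⊎-dec (adjᴳ? g g' ×-dec (h ≟ᴴ h'))

square-adj? : ∀ G → Searchable (V G) → DecidableEquality (V G) →
              Decidable (Adj G) → Decidable (Adj (square G))
square-adj? G search _≟ᴳ_ adj? u v =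
  ¬? (u ≟ᴳ v) ×-dec (adj? u v ⊎-dec search λ w → adj? u w ×-dec adj? w v)

record Embedding (G H : Graph) : Set where
  field
    to        : V G → V H
    injective : Injective _≡_ _≡_ to
    adj       : ∀ {u v} → Adj G u v → Adj H (to u) (to v)

□-embedding : ∀ G {H K} → Embedding H K → Embedding (G □ H) (G □ K)
□-embedding G e = record
  { to        = map₂ to
  ; injective = λ eq → ×-≡,≡→≡ (cong proj₁ eq , injective (cong proj₂ eq))
  ; adj       = Sum.map (map₂ adj) (map₂ (cong to))
  } where open Embedding e

-- An edge-preserving map carries a common neighbour to a common neighbour, and injectivity keeps
-- distinct vertices distinct, so edges of the square map to edges of the square.
square-colorable-restrict : ∀ {G H k} → Embedding G H →
                            Colorable (square H) k → Colorable (square G) k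
square-colorable-restrict e (c , proper) =
  c ∘ to , λ u v (u≢v , near) → proper (to u) (to v)
    (u≢v ∘ injective , Sum.map adj (λ (w , p , q) → to w , adj p , adj q) near)
  where open Embedding e

P₃ : Graph
P₃ = record
  { V   = Fin 3
  ; Adj = λ i j → toℕ j ≡ suc (toℕ i) ⊎ toℕ i ≡ suc (toℕ j)
  }

P₃-adj? : Decidable (Adj P₃)
P₃-adj? i j = (toℕ j ℕ.≟ _) ⊎-dec (toℕ i ℕ.≟ _)

P₃-embeds : ∀ k → Embedding P₃ (Cycle (2 + k))
P₃-embeds k = record
  { to        = _↑ˡ k
  ; injective = ↑ˡ-injective k _ _
  ; adj       = λ {i} {j} → Sum.map (succ i j) (succ j i)
  }
  where
  -- A path edge never wraps around: its upper end is below `3 + k`, so reduction modulo `3 + k`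
  -- leaves it fixed.
  succ : ∀ i j → toℕ j ≡ suc (toℕ i) → toℕ (j ↑ˡ k) ≡ suc (toℕ (i ↑ˡ k)) % (3 + k)
  succ i j eq = trans (sym (m<n⇒m%n≡m (toℕ<n (j ↑ˡ k)))) (cong (_% (3 + k)) step)
    where
    step : toℕ (j ↑ˡ k) ≡ suc (toℕ (i ↑ˡ k))
    step = trans (toℕ-↑ˡ j k) (trans eq (cong suc (sym (toℕ-↑ˡ i k))))

-- Lower bound on three rows, by finite checks

strip : Graph
strip = C₆ □ P₃

_~_ : V strip → V strip → Set
_~_ = Adj (square strip)

_~?_ : Decidable _~_
_~?_ = square-adj? strip (search-× any? any?) (≡-dec _≟_ _≟_)
         (□-adj? C₆ P₃ _≟_ _≟_ (Cycle-adj? 5) P₃-adj?)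

infixl 6 _⊕_

_⊕_ : Fin 6 → Fin 6 → Fin 6
x ⊕ y = (toℕ x + toℕ y) mod 6

-- (w , 0) followed by the closed neighbourhood of (x , 1).
star : (w x y : Fin 6) → Fin 6 → V strip
star w x y = lookup
  ((w , # 0) ∷ (x , # 0) ∷ (w , # 1) ∷ (x , # 1) ∷ (y , # 1) ∷ (x , # 2) ∷ [])

-- Positions 4 and 5 are `(y , 1)` and `(x , 2)`, the only two left possibly out of reach of
-- `(w , 0)`. The field `corner` serves to rule out the first.
record Star (w x y z : Fin 6) : Set where
  constructor mkStar
  field
    clique : ∀ i j → i <ᶠ j → star w x y i ~ star w x y j ⊎ i ≡ # 0 × (j ≡ # 4 ⊎ j ≡ # 5)
    corner : (z , # 0) ~ (y , # 1)

star? : ∀ w x y z → Dec (Star w x y z)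
star? w x y z = map′ (uncurry mkStar) (λ s → Star.clique s , Star.corner s)
  ((all? λ i → all? λ j → (i <? j) →-dec
      ((star w x y i ~? star w x y j) ⊎-dec ((i ≟ # 0) ×-dec ((j ≟ # 4) ⊎-dec (j ≟ # 5)))))
   ×-dec ((z , # 0) ~? (y , # 1)))

star-forward : ∀ x → Star x (x ⊕ # 1) (x ⊕ # 2) (x ⊕ # 3)
star-forward = from-yes (all? λ x → star? x (x ⊕ # 1) (x ⊕ # 2) (x ⊕ # 3))

star-backward : ∀ x → Star (x ⊕ # 3) (x ⊕ # 2) (x ⊕ # 1) x
star-backward = from-yes (all? λ x → star? (x ⊕ # 3) (x ⊕ # 2) (x ⊕ # 1) x)

near-or-antipodal : ∀ x y → x <ᶠ y → (x , # 0) ~ (y , # 0) ⊎ y ≡ x ⊕ # 3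
near-or-antipodal = from-yes (all? λ x → all? λ y → (x <? y) →-dec
  (((x , # 0) ~? (y , # 0)) ⊎-dec (y ≟ x ⊕ # 3)))

rim-adj : ∀ x → (x ⊕ # 1 , # 2) ~ (x ⊕ # 2 , # 2)
rim-adj = from-yes (all? λ x → (x ⊕ # 1 , # 2) ~? (x ⊕ # 2 , # 2))

module _ {m} (m<6 : m < 6) (c : V strip → Fin m) (proper : ∀ u v → u ~ v → c u ≢ c v) where

  -- Six vertices share fewer than six colours, so some pair collides, and only `(w , 0)` with
  -- `(y , 1)` or `(x , 2)` can. The former would give `(z , 0)` the colour of its near vertex
  -- `(y , 1)`.
  star-forces : ∀ {w x y z} → Star w x y z → c (w , # 0) ≡ c (z , # 0) →
                c (w , # 0) ≡ c (x , # 2)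
  star-forces {w} {x} {y} s w≡z with pigeonhole m<6 (c ∘ star w x y)
  ... | i , j , i<j , same with Star.clique s i j i<j
  ... | inj₁ near                = contradiction same (proper _ _ near)
  ... | inj₂ (refl , inj₁ refl) = contradiction (trans (sym w≡z) same) (proper _ _ (Star.corner s))
  ... | inj₂ (refl , inj₂ refl) = same

  strip-conflict : ∀ x → c (x , # 0) ≢ c (x ⊕ # 3 , # 0)
  strip-conflict x same = proper _ _ (rim-adj x)
    (trans (sym (star-forces (star-forward x) same))
      (trans same (star-forces (star-backward x) (sym same))))

strip²-not-colorable : ∀ m → m < 6 → ¬ Colorable (square strip) m
strip²-not-colorable m m<6 (c , proper) with pigeonhole m<6 (λ x → c (x , # 0))
... | x , y , x<y , same with near-or-antipodal x y x<y
... | inj₁ near = proper _ _ near same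
... | inj₂ refl = strip-conflict m<6 c proper x same

-- Upper bound: sequences of shifts

⊕-cancelʳ : ∀ x y a → x ⊕ a ≡ y ⊕ a → x ≡ y
⊕-cancelʳ = from-yes (all? λ x → all? λ y → all? λ a → (x ⊕ a ≟ y ⊕ a) →-dec (x ≟ y))

⊕-cancelˡ : ∀ x a b → x ⊕ a ≡ x ⊕ b → a ≡ b
⊕-cancelˡ = from-yes (all? λ x → all? λ a → all? λ b → (x ⊕ a ≟ x ⊕ b) →-dec (a ≟ b))

-- The difference `a - b` equals `y - x`, which is 1 or -1 modulo 6.
⊕-cancel-adj : ∀ x y a b → Adj C₆ x y → x ⊕ a ≡ y ⊕ b → Adj C₆ a b
⊕-cancel-adj = from-yes (all? λ x → all? λ y → all? λ a → all? λ b →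
  Cycle-adj? 5 x y →-dec ((x ⊕ a ≟ y ⊕ b) →-dec Cycle-adj? 5 a b))

record Step (a b c : Fin 6) : Set where
  constructor mkStep
  field
    distinct₁ : a ≢ b
    nonadj    : ¬ Adj C₆ a b
    distinct₂ : a ≢ c

step? : ∀ a b c → Dec (Step a b c)
step? a b c = map′ (λ (p , q , r) → mkStep p q r) (λ (mkStep p q r) → p , q , r)
  (¬? (a ≟ b) ×-dec (¬? (Cycle-adj? 5 a b) ×-dec ¬? (a ≟ c)))

-- Shifts s 0 = a, s 1 = b, …, s n = 0, s (n + 1) = 4.
data Walk : Fin 6 → Fin 6 → ℕ → Set where
  stop : Walk (# 0) (# 4) 0
  step : ∀ {a b c n} → Step a b c → Walk b c n → Walk a b (suc n)

infixr 5 _▸_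

_▸_ : ∀ a {b c n} {valid : True (step? a b c)} → Walk b c n → Walk a b (suc n)
_▸_ a {valid = valid} w = step (toWitness valid) w

-- The base lengths cover all residues modulo 3. Prefixing 0, 4, 2 adds three, and its steps look
-- ahead only to the 0, 4 that open the rest.
closed-walk : ∀ k → Walk (# 0) (# 4) (3 + k)
closed-walk 0                   = # 0 ▸ # 4 ▸ # 2 ▸ stop
closed-walk 1                   = # 0 ▸ # 4 ▸ # 1 ▸ # 3 ▸ stop
closed-walk 2                   = # 0 ▸ # 4 ▸ # 1 ▸ # 5 ▸ # 2 ▸ stop
closed-walk (suc (suc (suc k))) = # 0 ▸ # 4 ▸ # 2 ▸ closed-walk k

-- Meaningful up to j = n + 1 only.
at : ∀ {a b n} → Walk a b n → ℕ → Fin 6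
at {a = a} _          zero    = a
at {b = b} stop       (suc _) = b
at         (step _ w) (suc j) = at w j

at-1 : ∀ {a b n} (w : Walk a b n) → at w 1 ≡ b
at-1 stop       = refl
at-1 (step _ _) = refl

at-n : ∀ {a b n} (w : Walk a b n) → at w n ≡ # 0
at-n stop       = refl
at-n (step _ w) = at-n w

at-1+n : ∀ {a b n} (w : Walk a b n) → at w (suc n) ≡ # 4
at-1+n stop       = refl
at-1+n (step _ w) = at-1+n w

-- The last window, at `j = n - 1`, reads up to entry `n + 1`, which is why a walk fixes two entries
-- past its last step.
at-step : ∀ {a b n} (w : Walk a b n) {j} → j < n → Step (at w j) (at w (1 + j)) (at w (2 + j))
at-step (step s w) {zero}  _   = subst (Step _ _) (sym (at-1 w)) s
at-step (step _ w) {suc j} j<n = at-step w (s≤s⁻¹ j<n)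

-- Successors modulo n

suc-%-% : ∀ j n .{{_ : NonZero n}} → suc (j % n) % n ≡ suc j % n
suc-%-% j n = begin
  suc (j % n) % n           ≡⟨ %-distribˡ-+ 1 (j % n) n ⟩
  (1 % n + j % n % n) % n   ≡⟨ cong (λ r → (1 % n + r) % n) (m%n%n≡m%n j n) ⟩
  (1 % n + j % n) % n       ≡⟨ %-distribˡ-+ 1 j n ⟨
  suc j % n                 ∎
  where open ≡-Reasoning

-- Adding `m`, which is -1 modulo `suc m`, undoes the successor.
suc-%-cancel : ∀ m {i j} → suc i % suc m ≡ suc j % suc m → i % suc m ≡ j % suc m
suc-%-cancel m {i} {j} eq = trans (sym (undo i)) (trans (cong (λ r → (r + m % n) % n) eq) (undo j))
  where
  open ≡-Reasoning
  n = suc m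
  undo : ∀ k → (suc k % n + m % n) % n ≡ k % n
  undo k = begin
    (suc k % n + m % n) % n  ≡⟨ %-distribˡ-+ (suc k) m n ⟨
    (suc k + m) % n          ≡⟨ cong (_% n) (ℕ.+-suc k m) ⟨
    (k + n) % n              ≡⟨ [m+n]%n≡m%n k n ⟩
    k % n                    ∎

Cycle-pred-unique : ∀ m {i j : Fin (suc m)} →
                    suc (toℕ i) % suc m ≡ suc (toℕ j) % suc m → i ≡ j
Cycle-pred-unique m {i} {j} eq = toℕ-injective
  (trans (sym (m<n⇒m%n≡m (toℕ<n i))) (trans (suc-%-cancel m eq) (m<n⇒m%n≡m (toℕ<n j))))

-- The colouring from a closed walk

module _ {k} (w : Walk (# 0) (# 4) (2 + k)) where

  private
    n = 2 + k
    C = Cycle (suc k)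

  -- Entries `n` and `n + 1` repeat entries 0 and 1, namely 0 and 4, so the walk closes up around
  -- the cycle.
  at-% : ∀ {j} → j ≤ suc n → at w (j % n) ≡ at w j
  at-% {j} j≤1+n with ℕ.m≤n⇒m<n∨m≡n j≤1+n
  ... | inj₂ refl = trans (cong (at w) ([m+n]%n≡m%n 1 n)) (trans (at-1 w) (sym (at-1+n w)))
  ... | inj₁ j<1+n with ℕ.m≤n⇒m<n∨m≡n (s≤s⁻¹ j<1+n)
  ...   | inj₁ j<n  = cong (at w) (m<n⇒m%n≡m j<n)
  ...   | inj₂ refl = trans (cong (at w) (n%n≡0 n)) (sym (at-n w))

  shift : Fin n → Fin 6
  shift = at w ∘ toℕ

  shift-next : ∀ {i j : Fin n} → toℕ j ≡ suc (toℕ i) % n → shift j ≡ at w (1 + toℕ i)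
  shift-next {i} eq = trans (cong (at w) eq) (at-% (ℕ.m≤n⇒m≤1+n (toℕ<n i)))

  shift-next₂ : ∀ {i j l : Fin n} → toℕ j ≡ suc (toℕ i) % n → toℕ l ≡ suc (toℕ j) % n →
                shift l ≡ at w (2 + toℕ i)
  shift-next₂ {i} {j} {l} p q = trans
    (cong (at w) (trans q (trans (cong (λ r → suc r % n) p) (suc-%-% (suc (toℕ i)) n))))
    (at-% (s≤s (toℕ<n i)))

  shift-step : ∀ (i : Fin n) → Step (shift i) (at w (1 + toℕ i)) (at w (2 + toℕ i))
  shift-step i = at-step w (toℕ<n i)

  shift-distinct₁ : ∀ {i j} → Adj C i j → shift i ≢ shift j
  shift-distinct₁ {i} (inj₁ p) eq = Step.distinct₁ (shift-step i) (trans eq (shift-next p))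
  shift-distinct₁ {j = j} (inj₂ p) eq = Step.distinct₁ (shift-step j) (trans (sym eq) (shift-next p))

  shift-nonadj : ∀ {i j} → Adj C i j → ¬ Adj C₆ (shift i) (shift j)
  shift-nonadj {i} (inj₁ p) adj =
    Step.nonadj (shift-step i) (subst (Adj C₆ (shift i)) (shift-next p) adj)
  shift-nonadj {j = j} (inj₂ p) adj =
    Step.nonadj (shift-step j) (subst (Adj C₆ (shift j)) (shift-next p) (Sum.swap adj))

  shift-distinct₂ : ∀ {i j l} → Adj C i j → Adj C j l → i ≢ l → shift i ≢ shift l
  shift-distinct₂ {i} (inj₁ p) (inj₁ q) _ eq =
    Step.distinct₂ (shift-step i) (trans eq (shift-next₂ p q))
  shift-distinct₂ {l = l} (inj₂ p) (inj₂ q) _ eq =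
    Step.distinct₂ (shift-step l) (trans (sym eq) (shift-next₂ q p))
  -- A walk of two edges that turns back at `j` ends where it began.
  shift-distinct₂ (inj₁ p) (inj₂ q) i≢l _ = i≢l (Cycle-pred-unique (suc k) (trans (sym p) q))
  shift-distinct₂ (inj₂ p) (inj₁ q) i≢l _ = i≢l (toℕ-injective (trans p (sym q)))

  colour : V (C₆ □ C) → Fin 6
  colour (x , i) = x ⊕ shift i

  colour-diagonal : ∀ {x y i j} → Adj C₆ x y → Adj C i j → colour (x , i) ≢ colour (y , j)
  colour-diagonal {x} {y} x~y i~j = shift-nonadj i~j ∘ ⊕-cancel-adj x y _ _ x~y

  colour-proper : ∀ u v → Adj (square (C₆ □ C)) u v → colour u ≢ colour v
  colour-proper (x , i) (y , j) (u≢v , inj₁ (inj₁ (refl , i~j))) =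
    shift-distinct₁ i~j ∘ ⊕-cancelˡ x _ _
  colour-proper (x , i) (y , j) (u≢v , inj₁ (inj₂ (x~y , refl))) =
    u≢v ∘ cong (_, i) ∘ ⊕-cancelʳ x y _
  colour-proper (x , i) (y , j) (u≢v , inj₂ (_ , inj₁ (refl , p) , inj₁ (refl , q))) =
    shift-distinct₂ p q (u≢v ∘ cong (x ,_)) ∘ ⊕-cancelˡ x _ _
  colour-proper (x , i) (y , j) (u≢v , inj₂ (_ , inj₁ (refl , p) , inj₂ (q , refl))) =
    colour-diagonal q p
  colour-proper (x , i) (y , j) (u≢v , inj₂ (_ , inj₂ (p , refl) , inj₁ (refl , q))) =
    colour-diagonal p q
  colour-proper (x , i) (y , j) (u≢v , inj₂ (_ , inj₂ (p , refl) , inj₂ (q , refl))) =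
    u≢v ∘ cong (_, i) ∘ ⊕-cancelʳ x y _

theorem8 : (n : ℕ) → 6 ≤ n → (m : ℕ) → n ≡ suc m → ChromaticNumberIs (square (Cycle 5 □ Cycle m)) 6
-- With `n = 3 + k`, `closed-walk k` has length `n`, and three consecutive rows of the torus contain
-- the strip.
theorem8 (suc (suc (suc k))) (s≤s (s≤s (s≤s _))) _ refl =
  (colour w , colour-proper w) ,
  λ m m<6 → strip²-not-colorable m m<6 ∘ square-colorable-restrict (□-embedding C₆ (P₃-embeds k))
  where w = closed-walk k
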